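{- There is a constant $C$ such that every 3-program $P$ with $n$ atoms has at most $C\times 1.70711^n$ stable models.
   Context: A clause is $p\leftarrow B$ or $\leftarrow B$ (a constraint), where $p$ is an atom and $B$ is a finite set of literals (atoms $a$ or negated atoms $\mathrm{not}(a)$). A propositional logic program is a finite set of clauses; it is a 3-program if every clause has at most 3 literals, counting the head. $M\subseteq\mathit{At}(P)$ is a stable model of $P$ if $M$ satisfies all constraints of $P$ and is the least model of the Gelfond–Lifschitz reduct $P^M$, obtained by deleting every non-constraint clause with some $\mathrm{not}(a)$, $a\in M$, in its body and deleting negated literals from the remaining non-constraint clauses. -}

module Defs where

open import Data.Nat using (ℕ; suc; _+_; _≤_)
open import Data.Fin using (Fin)
open import Data.Fin.Subset using (Subset; _∈_; _∉_; _⊆_)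
open import Data.Fin.Subset.Properties using (_∈?_)
open import Data.List using (List; []; _∷_; length; filter; mapMaybe)
open import Data.List.Relation.Unary.All using (All)
open import Data.List.Relation.Unary.Any using (Any)
open import Data.Maybe using (Maybe; just; nothing)
open import Data.Bool using (Bool; true; false)
open import Data.Product using (_×_; _,_)
open import Relation.Nullary using (¬_; yes; no)
open import Relation.Binary.PropositionalEquality using (_≡_)

data Literal (n : ℕ) : Set where
  pos : Fin n → Literal n
  neg : Fin n → Literal n

-- A clause  p ← B  (head = just p)  or a constraint  ← B  (head = nothing).
-- The body B (a finite set of literals) is represented by a list.
record Clause (n : ℕ) : Set where
  constructor _⇐_
  field
    head : Maybe (Fin n)
    body : List (Literal n)
open Clause public

Program : ℕ → Set
Program n = List (Clause n)

headSize : ∀ {n} → Maybe (Fin n) → ℕ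
headSize (just _) = 1
headSize nothing  = 0

clauseSize : ∀ {n} → Clause n → ℕ
clauseSize c = headSize (head c) + length (body c)

Is3Program : ∀ {n} → Program n → Set
Is3Program P = All (λ c → clauseSize c ≤ 3) P

litAtom : ∀ {n} → Literal n → Fin n
litAtom (pos a) = a
litAtom (neg a) = a

OccursIn : ∀ {n} → Fin n → Clause n → Set
OccursIn a c = (head c ≡ just a) ⊎' Any (λ l → litAtom l ≡ a) (body c)
  where
  open import Data.Sum using () renaming (_⊎_ to _⊎'_)

-- At(P) is all of Fin n: P has exactly n atoms (namely the elements of Fin n)
AtomsAre : ∀ {n} → Program n → Set
AtomsAre {n} P = (a : Fin n) → Any (OccursIn a) P

SatLit : ∀ {n} → Subset n → Literal n → Set
SatLit M (pos a) = a ∈ M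
SatLit M (neg a) = a ∉ M

SatBody : ∀ {n} → Subset n → List (Literal n) → Set
SatBody M B = All (SatLit M) B

SatConstraints : ∀ {n} → Subset n → Program n → Set
SatConstraints M P = All (λ c → head c ≡ nothing → ¬ SatBody M (body c)) P

-- Definite (negation-free, non-constraint) clauses  h ← b₁,…,bₖ
DefClause : ℕ → Set
DefClause n = Fin n × List (Fin n)

posAtoms : ∀ {n} → List (Literal n) → List (Fin n)
posAtoms [] = []
posAtoms (pos a ∷ B) = a ∷ posAtoms B
posAtoms (neg a ∷ B) = posAtoms B

blocked : ∀ {n} → Subset n → List (Literal n) → Bool
blocked M [] = false
blocked M (pos a ∷ B) = blocked M B
blocked M (neg a ∷ B) with a ∈? M
... | yes _ = true
... | no  _ = blocked M B

-- Gelfond–Lifschitz reduct P^M: constraints are dropped (they are handled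
-- separately), clauses with some not(a), a ∈ M, in the body are deleted, and
-- negated literals are deleted from the remaining clauses.
reductClause : ∀ {n} → Subset n → Clause n → Maybe (DefClause n)
reductClause M (nothing ⇐ B) = nothing
reductClause M (just p ⇐ B) with blocked M B
... | true  = nothing
... | false = just (p , posAtoms B)

reduct : ∀ {n} → Subset n → Program n → List (DefClause n)
reduct M P = mapMaybe (reductClause M) P

ModelOf : ∀ {n} → Subset n → List (DefClause n) → Set
ModelOf M Q = All (λ { (h , B) → All (_∈ M) B → h ∈ M }) Q

LeastModel : ∀ {n} → Subset n → List (DefClause n) → Set
LeastModel {n} M Q = ModelOf M Q × ((M' : Subset n) → ModelOf M' Q → M ⊆ M')

StableModel : ∀ {n} → Program n → Subset n → Set
StableModel P M = SatConstraints M P × LeastModel M (reduct M P)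

{-# OPTIONS --safe #-}

-- Read every rule p ← B as a clause with at most three literals.  A stable
-- model M satisfies these clauses, and since M ∖ {a} is not a model of the
-- reduct, every a ∈ M has a critical clause: one in which a is the only true
-- literal.  Both properties survive fixing some atoms and simplifying, so it
-- suffices to bound the number of such assignments by branching.  Put
-- z = 1 / 1.70711, the price of fixing one atom.
--
-- Branching on k ≤ 5 distinct two-literal clauses gains a factor g k.  If there
-- are only three-literal clauses, call {l , m} a link of x when x ∨ l ∨ m is a
-- clause.  Making x false turns its links into two-literal clauses; making an
-- atom a true forces both literals of some link of a to be false.  Hence with p
-- links of a and branching on a:
--   p ≤ 2                           z + 2 z³ ≤ 1;
--   p ≥ 5                           z + z g₅ ≤ 1;
--   p = 4 and ¬a occurs             z g₁ + z g₄ ≤ 1;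
--   two links of a share an atom    the two-literal clauses overlap, which is
--                                   cheap both for a false and for a true.
-- So all atoms have 3 or 4 pairwise disjoint links.  Then a clause with two
-- negative literals is cheap; next p = 3 gives z g₃ + 3 z³ g₂ ≤ 1, since making
-- the positive literal of a link false leaves two new two-literal clauses; and
-- when p = 4 throughout, all literals are positive and z g₄ + 4 z³ g₅ ≤ 1.
module Submission where

open import Defs
open import Data.Nat using (ℕ; suc; NonZero; _+_; _*_; _^_; _≤_; _<_; _≤ᵇ_; _≤?_; z≤n; s≤s; _≤′_; ≤′-reflexive; ≤′-step)
open import Data.Nat.Properties using (≤-refl; ≤-trans; ≤-reflexive; <-trans; ≤ᵇ⇒≤; ≤⇒≤′; *-mono-≤; *-monoˡ-≤; *-monoʳ-≤; *-distribʳ-+; *-assoc; *-identityˡ; ^-monoˡ-≤; +-mono-≤; +-suc; +-comm; m≤n⇒m⊓n≡m; allUpTo?; m≤n+m; m≤m+n; ≤-pred; ≤-antisym; ≰⇒>; *-cancelˡ-≤; +-cancelˡ-≤; m≤n⇒m≤1+n)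
open import Data.Nat.Tactic.RingSolver using (solve-∀)
open import Data.Bool using (Bool; true; false; not; T)
import Data.Bool as Bool
open import Data.Bool.Properties using (¬-not; not-¬)
open import Data.Fin using (Fin)
import Data.Fin as Fin
import Data.Fin.Properties as Fin
open import Data.Fin.Subset using (Subset; _∈_; _∉_; _-_; ∣_∣; ⊤)
open import Data.Fin.Subset.Properties using (_∈?_; nonempty?; ∈⊤; ∣⊤∣≡n; x∈p∧x≢y⇒x∈p-y; x∈p⇒∣p-x∣<∣p∣)
open import Data.List using (List; []; _∷_; _++_; length; filter; map; take; cartesianProduct; allFin)
open import Data.List.Properties using (length-take; filter-notAll; length-map; filter-accept; filter-some; length-++)
open import Data.List.Relation.Unary.All as All using (All; []; _∷_)
import Data.List.Relation.Unary.All.Properties as All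
open import Data.List.Relation.Unary.Any as Any using (Any; here; there; any?)
open import Data.List.Relation.Unary.Any.Properties using (¬Any[])
open import Data.List.Relation.Unary.AllPairs as AllPairs using (AllPairs; []; _∷_)
import Data.List.Relation.Unary.AllPairs.Properties as AllPairs
open import Data.List.Relation.Unary.Unique.Propositional using (Unique)
import Data.List.Relation.Unary.Unique.Propositional.Properties as Unique
open import Data.List.Membership.Propositional using (lose; find) renaming (_∈_ to _∈ˡ_)
open import Data.List.Membership.Propositional.Properties using (∈-filter⁺; ∈-filter⁻; ∈-cartesianProduct⁺; ∈-allFin)
open import Data.Product using (∃; ∃₂; _×_; _,_; proj₁; proj₂; swap)
open import Data.Product.Properties using (≡-dec)
open import Data.Sum using (_⊎_; inj₁; inj₂; [_,_]′)
open import Data.Empty using (⊥; ⊥-elim)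
open import Data.Unit as Unit using (tt)
open import Data.Maybe using (just; nothing)
open import Data.Vec using (lookup; _[_]≔_)
open import Data.Vec.Properties using (tabulate∘lookup; tabulate-cong; lookup∘update; lookup∘update′; []=⇒lookup; lookup⇒[]=)
open import Function using (_∘_; id)
open import Relation.Nullary using (¬_; Dec; yes; no; contradiction)
open import Relation.Nullary.Decidable using (toWitness; decidable-stable; ¬?; _⊎-dec_; _×-dec_; _→-dec_)
open import Relation.Unary using (Pred; Decidable)
open import Relation.Binary.PropositionalEquality using (_≡_; _≢_; refl; sym; trans; cong; subst; ≢-sym)
open import Relation.Binary.Definitions using (tri<; tri≈; tri>)
open import Level using (0ℓ)

-- Counting lists by partition.

length-partition : ∀ {A : Set} {P : Pred A 0ℓ} (P? : Decidable P) xs →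
  length (filter P? xs) + length (filter (¬? ∘ P?) xs) ≡ length xs
length-partition P? [] = refl
length-partition P? (x ∷ xs) with P? x
... | yes _ = cong suc (length-partition P? xs)
... | no  _ = trans (+-suc _ _) (cong suc (length-partition P? xs))

partition-≤ : ∀ {A : Set} {P : Pred A 0ℓ} (P? : Decidable P) xs {x y u v} →
  length (filter P? xs) * u ≤ x * v → length (filter (¬? ∘ P?) xs) * u ≤ y * v →
  length xs * u ≤ (x + y) * v
partition-≤ P? xs {x} {y} {u} {v} h⁺ h⁻ =
  ≤-trans (≤-reflexive (trans (cong (_* u) (sym (length-partition P? xs)))
                              (*-distribʳ-+ u (length (filter P? xs)) _)))
 (≤-trans (+-mono-≤ h⁺ h⁻) (≤-reflexive (sym (*-distribʳ-+ v x y))))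

AllPairs-zipAll : ∀ {A : Set} {P : Pred A 0ℓ} {R S : A → A → Set} →
  (∀ {x y} → P x → P y → R x y → S x y) →
  ∀ {xs} → All P xs → AllPairs R xs → AllPairs S xs
AllPairs-zipAll f [] [] = []
AllPairs-zipAll f (px ∷ pxs) (rx ∷ rxs) =
  All.zipWith (λ (py , r) → f px py r) (pxs , rx) ∷ AllPairs-zipAll f pxs rxs

two≤length : ∀ {A : Set} {x y : A} {xs} → x ∈ˡ xs → y ∈ˡ xs → x ≢ y → 2 ≤ length xs
two≤length (here refl) (here refl) x≢y = contradiction refl x≢y
two≤length {xs = _ ∷ _ ∷ _} _ _ _ = s≤s (s≤s z≤n)
two≤length {xs = _ ∷ []} (there ()) _ _
two≤length {xs = _ ∷ []} (here _) (there ()) _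

-- Literals and their truth values.

Lit : ℕ → Set
Lit n = Fin n × Bool

var : ∀ {n} → Lit n → Fin n
var = proj₁

infix 8 ∼_
∼_ : ∀ {n} → Lit n → Lit n
∼ (v , b) = v , not b

infix 4 _≟ˡ_
_≟ˡ_ : ∀ {n} (x y : Lit n) → Dec (x ≡ y)
_≟ˡ_ = ≡-dec Fin._≟_ Bool._≟_

same-var : ∀ {n} {x y : Lit n} → var x ≡ var y → x ≡ y ⊎ x ≡ ∼ y
same-var {x = v , b} {y = _ , c} refl with b Bool.≟ c
... | yes refl = inj₁ refl
... | no  b≢c  = inj₂ (cong (v ,_) (¬-not b≢c))

Sat : ∀ {n} → Subset n → Lit n → Set
Sat M l = lookup M (var l) ≡ proj₂ l

Sat? : ∀ {n} (M : Subset n) → Decidable (Sat M)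
Sat? M l = lookup M (var l) Bool.≟ proj₂ l

¬Sat⇒Sat∼ : ∀ {n} {M : Subset n} {l} → ¬ Sat M l → Sat M (∼ l)
¬Sat⇒Sat∼ = ¬-not

Sat∼⇒¬Sat : ∀ {n} {M : Subset n} {l} → Sat M (∼ l) → ¬ Sat M l
Sat∼⇒¬Sat s∼ s = not-¬ s (s∼)

Sat-injective : ∀ {n} {M : Subset n} {x y} → Sat M x → Sat M y → var x ≡ var y → x ≡ y
Sat-injective {x = v , _} sx sy refl = cong (v ,_) (trans (sym sx) sy)

-- Branching weights and their numerical inequalities.

-- Weights are in units of 10⁻⁶ and rounded up: Z j stands for zʲ.  The tables
-- are only meaningful for j ≤ 5 and k ≤ 5.
one : ℕ
one = 1000000

Z : ℕ → ℕ
Z 0 = one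
Z 1 = 585786
Z 2 = 343145
Z 3 = 201010
Z 4 = 117749
Z _ = 68976

-- `g k` stands for (z + z²)ᵏ: a clause l ∨ m isolated from the others costs z when l is true, and
-- z² when l is false and m is forced.
g : ℕ → ℕ
g 0 = one
g 1 = 928931
g 2 = 862913
g 3 = 801586
g 4 = 744618
g _ = 691699

-- Abstract, because otherwise the type checker unfolds products such as
-- 100000 * x in unary.
abstract
  A B D : ℕ
  A = 100000
  B = 170711
  D = one

  A≡ : A ≡ 100000
  A≡ = refl

  B≡ : B ≡ 170711
  B≡ = refl

  D≡one : D ≡ one
  D≡one = refl

  chk : ∀ {x w} {_ : T (100000 * x ≤ᵇ 170711 * w)} → A * x ≤ B * w
  chk {x} {w} {c} = ≤ᵇ⇒≤ (100000 * x) (170711 * w) c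

  A≤B : A ≤ B
  A≤B = ≤ᵇ⇒≤ 100000 170711 tt

  Z-step : ∀ j → A * Z j ≤ B * Z (suc j)
  Z-step 0 = ≤ᵇ⇒≤ _ _ tt
  Z-step 1 = ≤ᵇ⇒≤ _ _ tt
  Z-step 2 = ≤ᵇ⇒≤ _ _ tt
  Z-step 3 = ≤ᵇ⇒≤ _ _ tt
  Z-step 4 = ≤ᵇ⇒≤ _ _ tt
  Z-step (suc (suc (suc (suc (suc _))))) = ≤ᵇ⇒≤ _ _ tt

  g-shared-table : ∀ {i} → i < 6 → ∀ {j} → j < 6 → i + (2 + j) ≤ 5 →
    A * (g i + Z (2 + j)) ≤ B * g (i + (2 + j))
  g-shared-table = toWitness {a? = allUpTo? (λ i → allUpTo? (λ j →
    (i + (2 + j) ≤? 5) →-dec (A * (g i + Z (2 + j)) ≤? B * g (i + (2 + j)))) 6) 6} tt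

  -- The witness is z times `g k`, rounded up; it is the cost once the first literal is false and
  -- the second one is forced.
  g-isolated-step : ∀ {k} → k < 5 → ∃ λ w → A * g k ≤ B * w × A * (g k + w) ≤ B * g (suc k)
  g-isolated-step {0} _ = 585786 , ≤ᵇ⇒≤ _ _ tt , ≤ᵇ⇒≤ _ _ tt
  g-isolated-step {1} _ = 544155 , ≤ᵇ⇒≤ _ _ tt , ≤ᵇ⇒≤ _ _ tt
  g-isolated-step {2} _ = 505482 , ≤ᵇ⇒≤ _ _ tt , ≤ᵇ⇒≤ _ _ tt
  g-isolated-step {3} _ = 469558 , ≤ᵇ⇒≤ _ _ tt , ≤ᵇ⇒≤ _ _ tt
  g-isolated-step {4} _ = 436187 , ≤ᵇ⇒≤ _ _ tt , ≤ᵇ⇒≤ _ _ tt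
  g-isolated-step {suc (suc (suc (suc (suc _))))} (s≤s (s≤s (s≤s (s≤s (s≤s ())))))

-- A literal in j ≥ 2 of k clauses costs no more than k isolated clauses do: branching on it either
-- leaves i clauses or forces j literals.
g-shared : ∀ {i j k} → 2 ≤ j → j + i ≡ k → k ≤ 5 → A * (g i + Z j) ≤ B * g k
g-shared {i} {j@(suc (suc j′))} (s≤s (s≤s z≤n)) refl h rewrite +-comm j i =
  g-shared-table (s≤s (≤-trans (m≤m+n i _) h))
    (s≤s (≤-trans (m≤n+m j′ 2) (≤-trans (m≤n+m j i) h))) h

-- 686290 is 2 z², which is below even the smallest value `g 5`.
g≥complementary : ∀ k → 686290 ≤ g k
g≥complementary 0 = ≤ᵇ⇒≤ _ _ tt
g≥complementary 1 = ≤ᵇ⇒≤ _ _ tt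
g≥complementary 2 = ≤ᵇ⇒≤ _ _ tt
g≥complementary 3 = ≤ᵇ⇒≤ _ _ tt
g≥complementary 4 = ≤ᵇ⇒≤ _ _ tt
g≥complementary (suc (suc (suc (suc (suc _))))) = ≤ᵇ⇒≤ _ _ tt

-- The first additional free atom pays for the factor z, by `A * x ≤ B * w`; any further ones only
-- help, because `A ≤ B`.
shrink-≤ : ∀ {k x w r s} → k * (D * A ^ r) ≤ x * B ^ r → A * x ≤ B * w → r < s →
  k * (D * A ^ s) ≤ w * B ^ s
shrink-≤ {k} {x} {w} {r} h Ax≤Bw r<s = raise (≤⇒≤′ r<s)
  where
  step : ∀ {y v} t → k * (D * A ^ t) ≤ y * B ^ t → A * y ≤ B * v →
    k * (D * A ^ suc t) ≤ v * B ^ suc t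
  step {y} {v} t h′ Ay≤Bv =
    ≤-trans (≤-reflexive (pull k D A (A ^ t)))
   (≤-trans (*-monoʳ-≤ A h′)
   (≤-trans (≤-reflexive (sym (*-assoc A y (B ^ t))))
   (≤-trans (*-monoˡ-≤ (B ^ t) Ay≤Bv) (≤-reflexive (push B v (B ^ t))))))
    where
    pull : ∀ k d a p → k * (d * (a * p)) ≡ a * (k * (d * p))
    pull = solve-∀
    push : ∀ b v p → b * v * p ≡ v * (b * p)
    push = solve-∀
  raise : ∀ {s} → suc r ≤′ s → k * (D * A ^ s) ≤ w * B ^ s
  raise (≤′-reflexive refl) = step r h Ax≤Bw
  raise (≤′-step {s} p)     = step s (raise p) (*-monoˡ-≤ w A≤B)

-- Counting assignments with some atoms fixed.

module Counting {n : ℕ} (Adm : Subset n → Set) where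

  Agree : Subset n → List (Subset n) → Set
  Agree U Ms = ∀ {M M′} → M ∈ˡ Ms → M′ ∈ˡ Ms → ∀ v → v ∉ U → lookup M v ≡ lookup M′ v

  -- At most (x / 10⁶) · 1.70711^∣U∣ admissible assignments satisfy S, once the
  -- values outside U are fixed.
  record Bd (U : Subset n) (S : Pred (Subset n) 0ℓ) (x : ℕ) : Set where
    constructor mkBd
    field
      bound : ∀ Ms → Unique Ms → All Adm Ms → Agree U Ms → All S Ms →
        length Ms * (D * A ^ ∣ U ∣) ≤ x * B ^ ∣ U ∣
  open Bd public

  Bd-empty : ∀ {U S x} → (∀ {M} → S M → ⊥) → Bd U S x
  Bd-empty ¬S .bound []      _ _ _ _        = z≤n
  Bd-empty ¬S .bound (M ∷ _) _ _ _ (sM ∷ _) = ⊥-elim (¬S sM)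

  Bd-⊆ : ∀ {U S S′ x} → (∀ {M} → S M → S′ M) → Bd U S′ x → Bd U S x
  Bd-⊆ f bd .bound Ms u ad ag al = bd .bound Ms u ad ag (All.map f al)

  Bd-≤ : ∀ {U S x y} → x ≤ y → Bd U S x → Bd U S y
  Bd-≤ x≤y bd .bound Ms u ad ag al = ≤-trans (bd .bound Ms u ad ag al) (*-monoˡ-≤ _ x≤y)

  module _ {P : Pred (Subset n) 0ℓ} (P? : Decidable P) where

    Agree-filter : ∀ {U Ms} → Agree U Ms → Agree U (filter P? Ms)
    Agree-filter ag i j = ag (proj₁ (∈-filter⁻ P? i)) (proj₁ (∈-filter⁻ P? j))

    All-filter : ∀ {S : Pred (Subset n) 0ℓ} {Ms} → All S Ms → All (λ M → S M × P M) (filter P? Ms)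
    All-filter {Ms = Ms} al = All.zip (All.filter⁺ P? al , All.all-filter P? Ms)

  -- A case distinction that fixes no atom, so the bounds add up without a factor z.
  Bd-∪ : ∀ {P : Pred (Subset n) 0ℓ} (P? : Decidable P) {U S x y} →
    Bd U (λ M → S M × P M) x → Bd U (λ M → S M × ¬ P M) y → Bd U S (x + y)
  Bd-∪ P? {U} {S} {x} {y} bx by .bound Ms u ad ag al =
    partition-≤ P? Ms {x} {y} h⁺ h⁻
    where
    h⁺ = bx .bound _ (Unique.filter⁺ P? u) (All.filter⁺ P? ad) (Agree-filter P? ag) (All-filter P? al)
    h⁻ = by .bound _ (Unique.filter⁺ (¬? ∘ P?) u) (All.filter⁺ (¬? ∘ P?) ad)
           (Agree-filter (¬? ∘ P?) ag) (All-filter (¬? ∘ P?) al)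

  private
    Agree-fix : ∀ {U Ms} l → Agree U Ms → All (λ M → Sat M l) Ms → Agree (U - var l) Ms
    Agree-fix {U} l ag fixed i j v v∉ with v Fin.≟ var l
    ... | yes refl = trans (All.lookup fixed i) (sym (All.lookup fixed j))
    ... | no  v≢   = ag i j v (λ v∈ → v∉ (x∈p∧x≢y⇒x∈p-y v∈ v≢))

  -- Both values of `l` fix its atom, so together the branches cost z (x + y).
  split : ∀ {U S x y w} l → var l ∈ U → A * (x + y) ≤ B * w →
    Bd (U - var l) (λ M → S M × Sat M l) x →
    Bd (U - var l) (λ M → S M × Sat M (∼ l)) y → Bd U S w
  split {U} {S} {x} {y} {w} l l∈ le bx by .bound Ms u ad ag al =
    shrink-≤ {length Ms} {x + y} {w} {∣ U - var l ∣}
      (partition-≤ P? Ms {x} {y} h⁺ h⁻) le (x∈p⇒∣p-x∣<∣p∣ l∈)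
    where
    P? : Decidable (λ M → Sat M l)
    P? M = Sat? M l
    al⁺ = All-filter P? al
    al⁻ = All.map (λ { {M} (s , ¬l) → s , ¬Sat⇒Sat∼ {M = M} ¬l }) (All-filter (¬? ∘ P?) al)
    h⁺ = bx .bound _ (Unique.filter⁺ P? u) (All.filter⁺ P? ad)
           (Agree-fix l (Agree-filter P? ag) (All.map proj₂ al⁺)) al⁺
    h⁻ = by .bound _ (Unique.filter⁺ (¬? ∘ P?) u) (All.filter⁺ (¬? ∘ P?) ad)
           (Agree-fix (∼ l) (Agree-filter (¬? ∘ P?) ag) (All.map proj₂ al⁻)) al⁻

  force : ∀ {U S x w} l → var l ∈ U → (∀ {M} → S M → Sat M l) → A * x ≤ B * w →
    Bd (U - var l) S x → Bd U S w
  force {U} {x = x} {w} l l∈ sat le bd .bound Ms u ad ag al =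
    shrink-≤ {length Ms} {x} {w} {∣ U - var l ∣}
      (bd .bound Ms u ad (Agree-fix l ag (All.map sat al)) al) le (x∈p⇒∣p-x∣<∣p∣ l∈)

-- Two-literal clauses as pairs of literals.

Pair : ℕ → Set
Pair n = Lit n × Lit n

Has : ∀ {n} → Lit n → Pair n → Set
Has l (x , y) = x ≡ l ⊎ y ≡ l

Has? : ∀ {n} (l : Lit n) → Decidable (Has l)
Has? l (x , y) = (x ≟ˡ l) ⊎-dec (y ≟ˡ l)

Touches : ∀ {n} → Fin n → Pair n → Set
Touches v (x , y) = var x ≡ v ⊎ var y ≡ v

Touches? : ∀ {n} (v : Fin n) → Decidable (Touches v)
Touches? v (x , y) = (var x Fin.≟ v) ⊎-dec (var y Fin.≟ v)

Touches⇒Has : ∀ {n} {l : Lit n} {q} → Touches (var l) q → Has l q ⊎ Has (∼ l) q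
Touches⇒Has (inj₁ e) = [ inj₁ ∘ inj₁ , inj₂ ∘ inj₁ ]′ (same-var e)
Touches⇒Has (inj₂ e) = [ inj₁ ∘ inj₂ , inj₂ ∘ inj₂ ]′ (same-var e)

-- Distinctness of unordered pairs, since l ∨ m and m ∨ l are the same clause.
Differ : ∀ {n} → Pair n → Pair n → Set
Differ (x , y) (x′ , y′) = ¬ (x ≡ x′ × y ≡ y′) × ¬ (x ≡ y′ × y ≡ x′)

other : ∀ {n} → Lit n → Pair n → Lit n
other l (x , y) with x ≟ˡ l
... | yes _ = y
... | no  _ = x

other-spec : ∀ {n} {l : Lit n} {q} → Has l q → q ≡ (l , other l q) ⊎ q ≡ (other l q , l)
other-spec {l = l} {x , y} h with x ≟ˡ l | h
... | yes refl | _         = inj₁ refl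
... | no  x≢l  | inj₁ x≡l  = contradiction x≡l x≢l
... | no  _    | inj₂ refl = inj₂ refl

other-differ : ∀ {n} {l : Lit n} {q q′} → Has l q → Has l q′ → Differ q q′ → other l q ≢ other l q′
other-differ {l = l} {q} {q′} h h′ (d₁ , d₂) e with other l q | other l q′ | other-spec h | other-spec h′
... | _ | _ | inj₁ refl | inj₁ refl = d₁ (refl , e)
... | _ | _ | inj₁ refl | inj₂ refl = d₂ (refl , e)
... | _ | _ | inj₂ refl | inj₁ refl = d₂ (e , refl)
... | _ | _ | inj₂ refl | inj₂ refl = d₁ (e , refl)

-- Branching on two-literal clauses.

module TwoClauses {n : ℕ} (Adm : Subset n → Set) (r : ℕ)
  (ih : ∀ {U S} → ∣ U ∣ < r → Counting.Bd Adm U S one) where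

  open Counting Adm

  Small : Subset n → Set
  Small U = ∣ U ∣ < r

  Small-minus : ∀ {U v} → v ∈ U → Small U → Small (U - v)
  Small-minus v∈ = <-trans (x∈p⇒∣p-x∣<∣p∣ v∈)

  record Edge (U : Subset n) (S : Pred (Subset n) 0ℓ) (q : Pair n) : Set where
    constructor edge
    field
      apart : var (proj₁ q) ≢ var (proj₂ q)
      freeˡ : var (proj₁ q) ∈ U
      freeʳ : var (proj₂ q) ∈ U
      holds : ∀ {M} → S M → Sat M (proj₁ q) ⊎ Sat M (proj₂ q)

  Edge-swap : ∀ {U S x y} → Edge U S (x , y) → Edge U S (y , x)
  Edge-swap (edge a f f′ h) = edge (≢-sym a) f′ f ([ inj₂ , inj₁ ]′ ∘ h)

  Edge-other : ∀ {U S l q} → Has l q → Edge U S q → Edge U S (l , other l q)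
  Edge-other {l = l} {q} h e with other l q | other-spec h
  ... | _ | inj₁ refl = e
  ... | _ | inj₂ refl = Edge-swap e

  Edge-¬Has∼ : ∀ {U S l q} → Has l q → Edge U S q → ¬ Has (∼ l) q
  Edge-¬Has∼ (inj₁ refl) e (inj₁ x≡∼x) = not-¬ refl (cong proj₂ x≡∼x)
  Edge-¬Has∼ (inj₁ refl) e (inj₂ refl) = Edge.apart e refl
  Edge-¬Has∼ (inj₂ refl) e (inj₁ refl) = Edge.apart e refl
  Edge-¬Has∼ (inj₂ refl) e (inj₂ x≡∼x) = not-¬ refl (cong proj₂ x≡∼x)

  Edge-freeHas : ∀ {U S l q} → Has l q → Edge U S q → var l ∈ U
  Edge-freeHas (inj₁ refl) = Edge.freeˡ
  Edge-freeHas (inj₂ refl) = Edge.freeʳ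

  Edge-restrict : ∀ {U S S′ v q} → (∀ {M} → S′ M → S M) → ¬ Touches v q →
    Edge U S q → Edge (U - v) S′ q
  Edge-restrict S′⊆S ¬t (edge a f f′ h) =
    edge a (x∈p∧x≢y⇒x∈p-y f (¬t ∘ inj₁)) (x∈p∧x≢y⇒x∈p-y f′ (¬t ∘ inj₂)) (h ∘ S′⊆S)

  force-other : ∀ {U S l m x w} → Edge U S (l , m) → A * x ≤ B * w →
    Bd (U - var l - var m) (λ M → S M × Sat M (∼ l)) x →
    Bd (U - var l) (λ M → S M × Sat M (∼ l)) w
  force-other {l = l} {m} (edge a f f′ h) le =
    force m (x∈p∧x≢y⇒x∈p-y f′ (≢-sym a))
      (λ {M} (s , ¬l) → [ (λ sl → ⊥-elim (Sat∼⇒¬Sat {M = M} {l} ¬l sl)) , id ]′ (h s)) le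

  -- Distinct literals on one atom are complementary, and then nothing satisfies `S`; otherwise each
  -- literal fixes an atom of its own and contributes a factor z.
  force-all : ∀ {U S} ls → AllPairs _≢_ ls → All (λ l → var l ∈ U) ls →
    (∀ {M} → S M → All (Sat M) ls) → Small U → Bd U S (Z (length ls))
  force-all [] _ _ _ sm = ih sm
  force-all {U} {S} (l ∷ ls) (l≢ ∷ ≢s) (l∈ ∷ ∈s) sat sm
    with any? (λ t → var t Fin.≟ var l) ls
  ... | yes clash = Bd-empty λ {M} s → clash-absurd M (sat s)
    where
    clash-absurd : ∀ M → All (Sat M) (l ∷ ls) → ⊥
    clash-absurd M (sl ∷ sls) =
      All.lookupWith (λ (l≢t , st) e → l≢t (Sat-injective {M = M} sl st (sym e))) (All.zip (l≢ , sls)) clash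
  ... | no ¬clash = force l l∈ (λ s → All.head (sat s)) (Z-step (length ls))
    (force-all ls ≢s
      (All.zipWith (λ (t∈ , t≢) → x∈p∧x≢y⇒x∈p-y t∈ t≢) (∈s , All.¬Any⇒All¬ ls ¬clash))
      (λ s → All.tail (sat s)) (Small-minus l∈ sm))

  -- 686290 stands for 2 z².
  complementary : ∀ {U S l m s} → Edge U S (l , m) → Edge U S (∼ l , s) → Small U → Bd U S 686290
  complementary {U} {S} {l} {m} {s} e@(edge a f f′ h) (edge a₂ f₂ f₂′ h₂) sm =
    split {x = Z 1} {Z 1} l f chk
      (force s (x∈p∧x≢y⇒x∈p-y f₂′ (≢-sym a₂))
        (λ {M} (sM , sl) → [ (λ s∼ → ⊥-elim (Sat∼⇒¬Sat {M = M} {l} s∼ sl)) , id ]′ (h₂ sM))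
        (Z-step 0) (ih (Small-minus (x∈p∧x≢y⇒x∈p-y f₂′ (≢-sym a₂)) (Small-minus f sm))))
      (force-other e (Z-step 0)
        (ih (Small-minus (x∈p∧x≢y⇒x∈p-y f′ (≢-sym a)) (Small-minus f sm))))

  -- If l is true the clauses containing it disappear; if l is false their other
  -- literals are all forced.
  shared : ∀ {U S w} l Q → var l ∈ U → All (Edge U S) Q → AllPairs Differ Q →
    All (¬_ ∘ Has (∼ l)) Q → Small U →
    let Qʳ = filter (¬? ∘ Has? l) Q in
    (∀ {U′ S′} → All (Edge U′ S′) Qʳ → AllPairs Differ Qʳ → Small U′ → Bd U′ S′ (g (length Qʳ))) →
    A * (g (length Qʳ) + Z (length (filter (Has? l) Q))) ≤ B * w → Bd U S w
  shared {U} {S} {w} l Q l∈ es ds ¬∼ sm rec le = split l l∈ le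
    (rec (All.zipWith (λ (e , ¬t) → Edge-restrict proj₁ ¬t e)
           (All.filter⁺ (¬? ∘ Has? l) es ,
            All.zipWith (λ (¬∼q , ¬q) → [ ¬q , ¬∼q ]′ ∘ Touches⇒Has)
              (All.filter⁺ (¬? ∘ Has? l) ¬∼ , All.all-filter (¬? ∘ Has? l) Q)))
         (AllPairs.filter⁺ (¬? ∘ Has? l) ds) sm′)
    (subst (Bd _ _) (cong Z (length-map (other l) Qˡ))
      (force-all (map (other l) Qˡ)
        (AllPairs.map⁺ (AllPairs-zipAll other-differ has (AllPairs.filter⁺ (Has? l) ds)))
        (All.map⁺ (All.map (λ (edge a _ f′ _) → x∈p∧x≢y⇒x∈p-y f′ (≢-sym a)) es′))
        (λ {M} (s , ¬l) → All.map⁺ (All.map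
          (λ e → [ (λ sl → ⊥-elim (Sat∼⇒¬Sat {M = M} {l} ¬l sl)) , id ]′ (Edge.holds e s)) es′))
        sm′))
    where
    Qˡ  = filter (Has? l) Q
    has = All.all-filter (Has? l) Q
    es′ : All (λ q → Edge U S (l , other l q)) Qˡ
    es′ = All.zipWith (λ (h , e) → Edge-other h e) (has , All.filter⁺ (Has? l) es)
    sm′ = Small-minus l∈ sm

  -- d only bounds the recursion.
  two-clauses : ∀ {U S} d Q → length Q ≤ d → length Q ≤ 5 →
    All (Edge U S) Q → AllPairs Differ Q → Small U → Bd U S (g (length Q))
  two-clauses d [] _ _ _ _ sm = ih sm
  two-clauses {U} {S} (suc d) Q@(q@(l , m) ∷ Q′) (s≤s ≤d) ≤5 es@(e ∷ es′) ds@(_ ∷ ds′) sm =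
    cases (touching l (inj₁ refl)) (touching m (inj₂ refl))
    where
    k = length Q

    -- If the atom of `x` reappears in `Q′`, the bound follows at once: from `complementary` if it
    -- reappears as `∼ x`, from `shared` if only as `x`.
    touching : ∀ x → Has x q → Bd U S (g k) ⊎ All (¬_ ∘ Touches (var x)) Q′
    touching x x∈q with any? (Has? (∼ x)) Q′ | any? (Has? x) Q′
    ... | yes h∼ | _ =
      let e′ , ∼x∈q′ = All.lookupAny es′ h∼ in
      inj₁ (Bd-≤ (g≥complementary k) (complementary (Edge-other x∈q e) (Edge-other ∼x∈q′ e′) sm))
    ... | no ¬∼ | no ¬h = inj₂ (All.zipWith (λ (a , b) → [ a , b ]′ ∘ Touches⇒Has)
                            (All.¬Any⇒All¬ Q′ ¬h , All.¬Any⇒All¬ Q′ ¬∼))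
    ... | no ¬∼ | yes h = inj₁ (shared x Q (Edge-freeHas x∈q e) es ds
      (Edge-¬Has∼ x∈q e ∷ All.¬Any⇒All¬ Q′ ¬∼) sm
      (λ es″ ds″ → two-clauses d Qʳ (≤-trans Qʳ≤ ≤d) (≤-trans Qʳ≤ (≤-trans (m≤n⇒m≤1+n ≤-refl) ≤5)) es″ ds″)
      (g-shared 2≤ (length-partition (Has? x) Q) ≤5))
      where
      Qʳ = filter (¬? ∘ Has? x) Q
      2≤ : 2 ≤ length (filter (Has? x) Q)
      2≤ = subst (2 ≤_) (cong length (sym (filter-accept (Has? x) {xs = Q′} x∈q)))
             (s≤s (filter-some (Has? x) h))
      Qʳ≤ : length Qʳ ≤ length Q′
      Qʳ≤ = ≤-pred (≤-trans (+-mono-≤ {1} (≤-trans (s≤s z≤n) 2≤) ≤-refl)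
                            (≤-reflexive (length-partition (Has? x) Q)))

    cases : Bd U S (g k) ⊎ All (¬_ ∘ Touches (var l)) Q′ →
      Bd U S (g k) ⊎ All (¬_ ∘ Touches (var m)) Q′ → Bd U S (g k)
    cases (inj₁ bd) _ = bd
    cases (inj₂ _) (inj₁ bd) = bd
    -- The first clause is isolated: `l` true leaves `Q′`, and `l` false forces `m` and leaves `Q′`
    -- as well.
    cases (inj₂ ¬l) (inj₂ ¬m) =
      let w , le₁ , le₂ = g-isolated-step ≤5
          es-l = All.zipWith (λ (¬t , e) → Edge-restrict proj₁ ¬t e) (¬l , es′)
          m∈   = x∈p∧x≢y⇒x∈p-y (Edge.freeʳ e) (≢-sym (Edge.apart e))
          sm-l = Small-minus (Edge.freeˡ e) sm
          <5   = ≤-trans (m≤n⇒m≤1+n ≤-refl) ≤5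
      in split l (Edge.freeˡ e) le₂
           (two-clauses d Q′ ≤d <5
             (All.zipWith (λ (¬t , e) → Edge-restrict proj₁ ¬t e) (¬l , es′)) ds′ sm-l)
           (force-other e le₁
             (two-clauses d Q′ ≤d <5
               (All.zipWith (λ (¬t , e) → Edge-restrict id ¬t e) (¬m , es-l)) ds′
               (Small-minus m∈ sm-l)))

  -- Surplus clauses are dropped, since the weights stop at five clauses.
  at-least : ∀ {U S} k Q → k ≤ 5 → k ≤ length Q →
    All (Edge U S) Q → AllPairs Differ Q → Small U → Bd U S (g k)
  at-least k Q k≤5 k≤ es ds sm =
    subst (λ j → Bd _ _ (g j)) eq
      (two-clauses k (take k Q) (≤-reflexive eq) (≤-trans (≤-reflexive eq) k≤5)
        (All.take⁺ k es) (AllPairs.take⁺ k ds) sm)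
    where
    eq : length (take k Q) ≡ k
    eq = trans (length-take k Q) (m≤n⇒m⊓n≡m k≤)

-- Enumerating pairs of literals, and the cost of overlapping links.

AllPairs-clash⇒length≤1 : ∀ {A : Set} {P : Pred A 0ℓ} {R : A → A → Set} →
  (∀ {x y} → P x → P y → R x y → ⊥) → ∀ {xs} → All P xs → AllPairs R xs → length xs ≤ 1
AllPairs-clash⇒length≤1 clash [] [] = z≤n
AllPairs-clash⇒length≤1 clash (_ ∷ []) _ = s≤s z≤n
AllPairs-clash⇒length≤1 clash (px ∷ py ∷ _) ((rxy ∷ _) ∷ _) = ⊥-elim (clash px py rxy)

allPairs : ∀ n → List (Pair n)
allPairs n = cartesianProduct lits lits
  where lits = cartesianProduct (allFin n) (true ∷ false ∷ [])

∈-allPairs : ∀ {n} (q : Pair n) → q ∈ˡ allPairs n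
∈-allPairs (x , y) = ∈-cartesianProduct⁺ (∈-lits x) (∈-lits y)
  where
  ∈-bools : ∀ b → b ∈ˡ true ∷ false ∷ []
  ∈-bools true  = here refl
  ∈-bools false = there (here refl)
  ∈-lits : ∀ l → l ∈ˡ cartesianProduct (allFin _) (true ∷ false ∷ [])
  ∈-lits (v , b) = ∈-cartesianProduct⁺ (∈-allFin v) (∈-bools b)

allPairs-unique : ∀ n → Unique (allPairs n)
allPairs-unique n = Unique.cartesianProduct⁺ lits! lits!
  where
  lits! = Unique.cartesianProduct⁺ (Unique.allFin⁺ n) (((λ ()) ∷ []) ∷ [] ∷ [])

infix 8 ⊕_ ⊖_
⊕_ ⊖_ : ∀ {n} → Fin n → Lit n
⊕ a = a , true
⊖ a = a , false

-- 745164 is z (`g 1` + z²): the worst case has exactly two of the three links sharing the literal.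
shared₃ : ∀ {i j} → 2 ≤ j → j + i ≡ 3 → A * (g i + Z j) ≤ B * 745164
shared₃ {j = 2} _ refl = chk
shared₃ {j = 3} _ refl = chk
shared₃ {j = 1} (s≤s ())
shared₃ {j = suc (suc (suc (suc _)))} _ ()

-- 706492 is z (`g 2` + z²), again the case of exactly two sharing links.
shared₄ : ∀ {i j} → 2 ≤ j → j + i ≡ 4 → A * (g i + Z j) ≤ B * 706492
shared₄ {j = 2} _ refl = chk
shared₄ {j = 3} _ refl = chk
shared₄ {j = 4} _ refl = chk
shared₄ {j = 1} (s≤s ())
shared₄ {j = suc (suc (suc (suc (suc _))))} _ ()

-- Branching on three-literal clauses.

-- C x y z says that the simplified formula contains the clause x ∨ y ∨ z.  The
-- contradiction hypothesis `unbounded` replaces every search for a suitable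
-- atom: an atom to which one of the cases applies cannot exist.
module Branching {n : ℕ} (Adm : Subset n → Set) (U : Subset n) (K : Pred (Subset n) 0ℓ)
  (ih : ∀ {U′ S} → ∣ U′ ∣ < ∣ U ∣ → Counting.Bd Adm U′ S one)
  (C : Lit n → Lit n → Lit n → Set) (C? : ∀ x y z → Dec (C x y z))
  (C-swap₁₂ : ∀ {x y z} → C x y z → C y x z)
  (C-swap₂₃ : ∀ {x y z} → C x y z → C x z y)
  (C-apart : ∀ {x y z} → C x y z → var x ≢ var y)
  (C-free : ∀ {x y z} → C x y z → var x ∈ U)
  (C-holds : ∀ {x y z M} → C x y z → K M → Sat M x ⊎ Sat M y ⊎ Sat M z)
  (critical : ∀ {a M} → a ∈ U → K M → Sat M (⊕ a) →
    ∃₂ λ l m → C (⊕ a) l m × Sat M (∼ l) × Sat M (∼ m))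
  (unbounded : ¬ Counting.Bd Adm U K one)
  where

  open Counting Adm
  open TwoClauses Adm ∣ U ∣ ih

  C-rotate : ∀ {x y z} → C x y z → C y z x
  C-rotate = C-swap₂₃ ∘ C-swap₁₂

  C-free₂ : ∀ {x y z} → C x y z → var y ∈ U
  C-free₂ = C-free ∘ C-rotate

  C-free₃ : ∀ {x y z} → C x y z → var z ∈ U
  C-free₃ = C-free₂ ∘ C-rotate

  C-apart₂₃ : ∀ {x y z} → C x y z → var y ≢ var z
  C-apart₂₃ = C-apart ∘ C-rotate

  C-apart₁₃ : ∀ {x y z} → C x y z → var x ≢ var z
  C-apart₁₃ = C-apart ∘ C-swap₂₃

  Link : Lit n → Pair n → Set
  Link x (y , z) = C x y z

  -- The order on atoms selects one of (y, z) and (z, y), so that each clause containing `x` is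
  -- counted once.
  links : Lit n → List (Pair n)
  links x = filter (λ (y , z) → C? x y z ×-dec (var y Fin.<? var z)) (allPairs n)

  links-sound : ∀ {x q} → q ∈ˡ links x → Link x q
  links-sound = proj₁ ∘ proj₂ ∘ ∈-filter⁻ _ {xs = allPairs n}

  links-All : ∀ {x} → All (Link x) (links x)
  links-All = All.tabulate links-sound

  links-complete : ∀ {x y z} → C x y z → (y , z) ∈ˡ links x ⊎ (z , y) ∈ˡ links x
  links-complete {x} {y} {z} c with Fin.<-cmp (var y) (var z)
  ... | tri< lt _ _ = inj₁ (∈-filter⁺ _ (∈-allPairs (y , z)) (c , lt))
  ... | tri≈ _ eq _ = contradiction eq (C-apart₂₃ c)
  ... | tri> _ _ gt = inj₂ (∈-filter⁺ _ (∈-allPairs (z , y)) (C-swap₂₃ c , gt))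

  links-differ : ∀ {x} → AllPairs Differ (links x)
  links-differ {x} = AllPairs-zipAll
    (λ (_ , lt) (_ , lt′) q≢ →
      (λ { (refl , refl) → q≢ refl }) , (λ { (refl , refl) → Fin.<-asym lt lt′ }))
    (All.all-filter _ (allPairs n)) (Unique.filter⁺ _ (allPairs-unique n))

  link-Edge : ∀ {U′ S x q} → (∀ {M} → S M → K M × Sat M (∼ x)) →
    (∀ {v} → v ∈ U → Touches v q → v ∈ U′) → Link x q → Edge U′ S q
  link-Edge {x = x} S⊆ free c = edge (C-apart₂₃ c) (free (C-free₂ c) (inj₁ refl)) (free (C-free₃ c) (inj₂ refl))
    λ {M} s → let k , ¬x = S⊆ s in
      [ (λ sx → ⊥-elim (Sat∼⇒¬Sat {M = M} {x} ¬x sx)) , id ]′ (C-holds c k)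

  Link-¬Touches : ∀ {x q v} → Link x q → Touches v q → v ≢ var x
  Link-¬Touches c (inj₁ refl) = ≢-sym (C-apart c)
  Link-¬Touches c (inj₂ refl) = ≢-sym (C-apart₁₃ c)

  small : ∀ {v} → v ∈ U → Small (U - v)
  small = x∈p⇒∣p-x∣<∣p∣

  links-Edges : ∀ {x} → All (Edge (U - var x) (λ M → K M × Sat M (∼ x))) (links x)
  links-Edges = All.map (λ c → link-Edge id (λ v∈ t → x∈p∧x≢y⇒x∈p-y v∈ (Link-¬Touches c t)) c) links-All

  falsify : ∀ x k → k ≤ 5 → k ≤ length (links x) → var x ∈ U →
    Bd (U - var x) (λ M → K M × Sat M (∼ x)) (g k)
  falsify x k k≤5 k≤ x∈ = at-least k (links x) k≤5 k≤ links-Edges links-differ (small x∈)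

  Falsified : Pair n → Pred (Subset n) 0ℓ
  Falsified (l , m) M = Sat M (∼ l) × Sat M (∼ m)

  Falsified? : ∀ q → Decidable (Falsified q)
  Falsified? (l , m) M = Sat? M (∼ l) ×-dec Sat? M (∼ m)

  Available : Subset n → Pair n → Set
  Available U′ (l , m) = var l ≢ var m × var l ∈ U′ × var m ∈ U′

  -- Splits according to the first pair of `L` that is falsified. Falsifying it fixes two atoms, for
  -- which the two inequalities charge z².
  link-cases : ∀ {U′ S x y z} L → All (Available U′) L →
    (∀ {M} → S M → Any (λ q → Falsified q M) L) → A * x ≤ B * y → A * y ≤ B * z →
    (∀ {l m} → (l , m) ∈ˡ L → Bd (U′ - var l - var m) (λ M → S M × Falsified (l , m) M) x) →
    Bd U′ S (length L * z)
  link-cases [] _ any _ _ _ = Bd-empty λ s → ¬Any[] (any s)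
  link-cases {S = S} (q@(l , m) ∷ L) ((l≢m , l∈ , m∈) ∷ av) any le₁ le₂ bd =
    Bd-∪ (Falsified? q)
      (force (∼ l) l∈ (proj₁ ∘ proj₂) le₂
        (force (∼ m) (x∈p∧x≢y⇒x∈p-y m∈ (≢-sym l≢m)) (proj₂ ∘ proj₂) le₁ (bd (here refl))))
      (link-cases L av (λ (s , ¬q) → Any.tail ¬q (any s)) le₁ le₂
        (λ i → Bd-⊆ (λ ((s , _) , f) → s , f) (bd (there i))))

  critical-link : ∀ {a M} → a ∈ U → K M → Sat M (⊕ a) → ∃ λ q → q ∈ˡ links (⊕ a) × Falsified q M
  critical-link a∈ k sa with l , m , c , ¬l , ¬m ← critical a∈ k sa | links-complete c
  ... | inj₁ i = _ , i , ¬l , ¬m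
  ... | inj₂ i = _ , i , ¬m , ¬l

  Available-minus : ∀ {x q} → Link x q → Available (U - var x) q
  Available-minus c = C-apart₂₃ c , x∈p∧x≢y⇒x∈p-y (C-free₂ c) (≢-sym (C-apart c))
                                  , x∈p∧x≢y⇒x∈p-y (C-free₃ c) (≢-sym (C-apart₁₃ c))

  -- If `a` is true, its critical clause falsifies one of its links, so the cost is a sum over the
  -- links.
  satisfy : ∀ {a x y z} → a ∈ U → A * x ≤ B * y → A * y ≤ B * z →
    (∀ {l m} → C (⊕ a) l m →
      Bd (U - a - var l - var m) (λ M → (K M × Sat M (⊕ a)) × Falsified (l , m) M) x) →
    Bd (U - a) (λ M → K M × Sat M (⊕ a)) (length (links (⊕ a)) * z)
  satisfy {a} a∈ le₁ le₂ bd = link-cases (links (⊕ a)) (All.map Available-minus links-All)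
    (λ (k , sa) → let _ , i , f = critical-link a∈ k sa in lose i f) le₁ le₂ (bd ∘ links-sound)

  small₃ : ∀ {a l m} → C (⊕ a) l m → Small (U - a - var l - var m)
  small₃ c = let l≢m , l∈ , m∈ = Available-minus c in
    Small-minus (x∈p∧x≢y⇒x∈p-y m∈ (≢-sym l≢m)) (Small-minus l∈ (small (C-free c)))

  3≤links : ∀ {a} → a ∈ U → 3 ≤ length (links (⊕ a))
  3≤links {a} a∈ with 3 ≤? length (links (⊕ a))
  ... | yes 3≤ = 3≤
  ... | no  3≰ = ⊥-elim (unbounded (split {x = 2 * Z 2} {one} (⊕ a) a∈ chk
    (Bd-≤ (*-monoˡ-≤ (Z 2) (≤-pred (≰⇒> 3≰))) (satisfy a∈ (Z-step 0) (Z-step 1) (ih ∘ small₃)))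
    (ih (small a∈))))

  links≤4 : ∀ {a} → a ∈ U → length (links (⊕ a)) ≤ 4
  links≤4 {a} a∈ with length (links (⊕ a)) ≤? 4
  ... | yes ≤4 = ≤4
  ... | no  ≰4 = ⊥-elim (unbounded (split {x = one} {g 5} (⊕ a) a∈ chk
    (ih (small a∈)) (falsify (⊕ a) 5 ≤-refl (≰⇒> ≰4) a∈)))

  -- The clause with ¬a becomes a two-literal clause when `a` is true; the four links do so when `a`
  -- is false.
  4≤links⇒positive : ∀ {a y z} → 4 ≤ length (links (⊕ a)) → ¬ C (⊖ a) y z
  4≤links⇒positive {a} 4≤ c = unbounded (split {x = g 1} {g 4} (⊕ a) a∈ chk
    (falsify (⊖ a) 1 (s≤s z≤n) (nonempty (links-complete c)) a∈)
    (falsify (⊕ a) 4 (≤ᵇ⇒≤ 4 5 tt) 4≤ a∈))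
    where
    a∈ = C-free c
    nonempty : ∀ {q q′ : Pair n} {L} → q ∈ˡ L ⊎ q′ ∈ˡ L → 1 ≤ length L
    nonempty (inj₁ (here _))  = s≤s z≤n
    nonempty (inj₁ (there _)) = s≤s z≤n
    nonempty (inj₂ (here _))  = s≤s z≤n
    nonempty (inj₂ (there _)) = s≤s z≤n

  -- For `a` false the clauses l ∨ m and ¬l ∨ s remain, at cost 2 z², and z + 2 z³ ≤ 1.
  no-complementary-links : ∀ {a l m s} → C (⊕ a) l m → ¬ C (⊕ a) (∼ l) s
  no-complementary-links {a} {l} c c′ = unbounded (split {x = one} {686290} (⊕ a) a∈ chk
    (ih (small a∈)) (complementary {l = l} (edge-of c) (edge-of c′) (small a∈)))
    where
    a∈ = C-free c
    edge-of : ∀ {q} → Link (⊕ a) q → Edge (U - a) (λ M → K M × Sat M (⊖ a)) q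
    edge-of c = link-Edge id (λ v∈ t → x∈p∧x≢y⇒x∈p-y v∈ (Link-¬Touches c t)) c

  module _ {a x y y′} (c : C (⊕ a) x y) (c′ : C (⊕ a) x y′) (y≢y′ : y ≢ y′) where

    private
      L  = links (⊕ a)
      Lˡ = filter (Has? x) L
      Lʳ = filter (¬? ∘ Has? x) L
      a∈ = C-free c

      2≤Lˡ : 2 ≤ length Lˡ
      2≤Lˡ with links-complete c | links-complete c′
      ... | inj₁ i | inj₁ j = two≤length (∈-filter⁺ _ i (inj₁ refl)) (∈-filter⁺ _ j (inj₁ refl)) λ { refl → y≢y′ refl }
      ... | inj₁ i | inj₂ j = two≤length (∈-filter⁺ _ i (inj₁ refl)) (∈-filter⁺ _ j (inj₂ refl)) λ { refl → y≢y′ refl }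
      ... | inj₂ i | inj₁ j = two≤length (∈-filter⁺ _ i (inj₂ refl)) (∈-filter⁺ _ j (inj₁ refl)) λ { refl → y≢y′ refl }
      ... | inj₂ i | inj₂ j = two≤length (∈-filter⁺ _ i (inj₂ refl)) (∈-filter⁺ _ j (inj₂ refl)) λ { refl → y≢y′ refl }

      ¬Has∼x : ∀ {q} → Link (⊕ a) q → ¬ Has (∼ x) q
      ¬Has∼x d (inj₁ refl) = no-complementary-links c d
      ¬Has∼x d (inj₂ refl) = no-complementary-links c (C-swap₂₃ d)

      -- For `a` true, the branching continues on `x`: if `x` is true, the falsified link cannot
      -- contain it and is one of the at most `p` links in `Lʳ`. For `a` false, `x` is shared by at
      -- least two of the resulting clauses.
      bounded : ∀ p {w₀ w₁} → length L ≡ 2 + p → 2 + p ≤ 5 →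
        A * (g (length Lʳ) + Z (length Lˡ)) ≤ B * w₀ →
        A * (p * Z 2 + one) ≤ B * w₁ → A * (w₁ + w₀) ≤ B * one → ⊥
      bounded p eq p≤ le₀ le₁ le = unbounded (split (⊕ a) a∈ le
        (split x x∈ le₁
          (Bd-≤ (*-monoˡ-≤ (Z 2) Lʳ≤p)
            (link-cases Lʳ available falsified (Z-step 0) (Z-step 1) λ i →
              let l≢m , l∈ , m∈ = All.lookup available i in
              ih (Small-minus (x∈p∧x≢y⇒x∈p-y m∈ (≢-sym l≢m)) (Small-minus l∈ small₂))))
          (ih small₂))
        (shared x L x∈ links-Edges links-differ (All.map ¬Has∼x links-All) (small a∈)
          (two-clauses 5 Lʳ Lʳ≤5 Lʳ≤5) le₀))
        where
        x∈ = x∈p∧x≢y⇒x∈p-y (C-free₂ c) (≢-sym (C-apart c))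
        small₂ = Small-minus x∈ (small a∈)
        Lʳ≤p : length Lʳ ≤ p
        Lʳ≤p = +-cancelˡ-≤ 2 _ _ (≤-trans (+-mono-≤ 2≤Lˡ ≤-refl)
                 (≤-reflexive (trans (length-partition (Has? x) L) eq)))
        Lʳ≤5 : length Lʳ ≤ 5
        Lʳ≤5 = ≤-trans Lʳ≤p (≤-trans (m≤n+m p 2) p≤)
        available : All (Available (U - a - var x)) Lʳ
        available = All.tabulate λ i →
          let j , ¬h = ∈-filter⁻ (¬? ∘ Has? x) {xs = L} i
              d = links-sound j
              ¬t = [ ¬h , ¬Has∼x d ]′ ∘ Touches⇒Has
              l≢m , l∈ , m∈ = Available-minus d
          in l≢m , x∈p∧x≢y⇒x∈p-y l∈ (¬t ∘ inj₁) , x∈p∧x≢y⇒x∈p-y m∈ (¬t ∘ inj₂)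
        falsified : ∀ {M} → (K M × Sat M (⊕ a)) × Sat M x → Any (λ q → Falsified q M) Lʳ
        falsified {M} ((k , sa) , sx) with q , i , f ← critical-link a∈ k sa =
          lose (∈-filter⁺ (¬? ∘ Has? x) i (¬Has f)) f
          where
          ¬Has : ∀ {q} → Falsified q M → ¬ Has x q
          ¬Has (¬l , _) (inj₁ refl) = Sat∼⇒¬Sat {M = M} ¬l sx
          ¬Has (_ , ¬m) (inj₂ refl) = Sat∼⇒¬Sat {M = M} ¬m sx

    no-shared-literal : ⊥
    no-shared-literal with length L ≤? 3
    -- 786795 here and 987804 for four links are z (p z² + 1), the cost once `a` is true.
    ... | yes ≤3 = bounded 1 {745164} {786795} eq (≤ᵇ⇒≤ 3 5 tt)
                     (shared₃ 2≤Lˡ (trans (length-partition (Has? x) L) eq)) chk chk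
      where eq = ≤-antisym ≤3 (3≤links a∈)
    ... | no ≰3  = bounded 2 {706492} {987804} eq (≤ᵇ⇒≤ 4 5 tt)
                     (shared₄ 2≤Lˡ (trans (length-partition (Has? x) L) eq)) chk chk
      where eq = ≤-antisym (links≤4 a∈) (≰⇒> ≰3)

  -- Opposite signs of the common atom are excluded by `no-complementary-links`, equal signs with
  -- different partners by `no-shared-literal`.
  links-disjoint : ∀ {a x y x′ y′} → C (⊕ a) x y → C (⊕ a) x′ y′ → var x ≡ var x′ → x ≡ x′ × y ≡ y′
  links-disjoint {x = x} {y} {x′} {y′} c c′ e with same-var {x = x} {x′} e
  ... | inj₂ refl = ⊥-elim (no-complementary-links c′ c)
  ... | inj₁ refl with y ≟ˡ y′
  ...   | yes refl = refl , refl
  ...   | no y≢y′  = ⊥-elim (no-shared-literal c c′ y≢y′)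

  touching-links : ∀ {a v q q′} → Link (⊕ a) q → Link (⊕ a) q′ → Touches v q → Touches v q′ → ¬ Differ q q′
  touching-links c c′ (inj₁ refl) (inj₁ e) (d₁ , _) = d₁ (links-disjoint c c′ (sym e))
  touching-links c c′ (inj₁ refl) (inj₂ e) (_ , d₂) = d₂ (links-disjoint c (C-swap₂₃ c′) (sym e))
  touching-links c c′ (inj₂ refl) (inj₁ e) (_ , d₂) = d₂ (swap (links-disjoint (C-swap₂₃ c) c′ (sym e)))
  touching-links c c′ (inj₂ refl) (inj₂ e) (d₁ , _) =
    d₁ (swap (links-disjoint (C-swap₂₃ c) (C-swap₂₃ c′) (sym e)))

  -- These links of `b` can still give two-literal clauses after `v` has been fixed as well.
  avoiding : Fin n → Fin n → List (Pair n)
  avoiding v b = filter (¬? ∘ Touches? v) (links (⊕ b))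

  -- Links of `b` are disjoint, so at most one of them touches `v`.
  avoiding-length : ∀ {k} v b → suc k ≤ length (links (⊕ b)) → k ≤ length (avoiding v b)
  avoiding-length v b k< = ≤-pred (≤-trans k< (≤-trans
    (≤-reflexive (sym (length-partition (Touches? v) (links (⊕ b)))))
    (+-mono-≤ (AllPairs-clash⇒length≤1 (λ (c , t) (c′ , t′) → touching-links c c′ t t′)
      (All.zip (All.filter⁺ (Touches? v) links-All , All.all-filter (Touches? v) (links (⊕ b))))
      (AllPairs.filter⁺ (Touches? v) links-differ)) ≤-refl)))

  avoiding-sound : ∀ {v b q} → q ∈ˡ avoiding v b → Link (⊕ b) q × ¬ Touches v q
  avoiding-sound {v} {b} i =
    let j , ¬t = ∈-filter⁻ (¬? ∘ Touches? v) {xs = links (⊕ b)} i in links-sound j , ¬t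

  avoiding-differ : ∀ {v b} → AllPairs Differ (avoiding v b)
  avoiding-differ = AllPairs.filter⁺ _ links-differ

  -- For `b` false its three links give `g 3`. For `b` true, branching on `c` either forces `x` or
  -- turns two links of `c` away from `b` into clauses; 848627 is z (z + `g 2`).
  no-two-negatives : ∀ {x b c} → ¬ C x (⊖ b) (⊖ c)
  no-two-negatives {x} {b} {c} d = unbounded (split {x = 848627} {g 3} (⊕ b) b∈ chk
    (split {x = Z 1} {g 2} (⊕ c) c∈ chk
      (force x x∈ x-true (Z-step 0) (ih (Small-minus x∈ small₂)))
      (at-least 2 (avoiding b c) (≤ᵇ⇒≤ 2 5 tt) (avoiding-length b c (3≤links (C-free₃ d)))
        (All.tabulate λ i → let l , ¬t = avoiding-sound i in
          link-Edge (λ ((k , _) , ¬c) → k , ¬c)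
            (λ v∈ t → x∈p∧x≢y⇒x∈p-y (x∈p∧x≢y⇒x∈p-y v∈ λ { refl → ¬t t }) (Link-¬Touches l t)) l)
        avoiding-differ small₂))
    (falsify (⊕ b) 3 (≤ᵇ⇒≤ 3 5 tt) (3≤links b∈) b∈))
    where
    b∈ = C-free₂ d
    c∈ = x∈p∧x≢y⇒x∈p-y (C-free₃ d) (≢-sym (C-apart₂₃ d))
    x∈ = x∈p∧x≢y⇒x∈p-y (x∈p∧x≢y⇒x∈p-y (C-free d) (C-apart d)) (C-apart₁₃ d)
    small₂ = Small-minus c∈ (small b∈)
    x-true : ∀ {M} → (K M × Sat M (⊕ b)) × Sat M (⊕ c) → Sat M x
    x-true {M} ((k , sb) , sc) with C-holds d k
    ... | inj₁ sx        = sx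
    ... | inj₂ (inj₁ ¬b) = ⊥-elim (Sat∼⇒¬Sat {M = M} {⊕ b} ¬b sb)
    ... | inj₂ (inj₂ ¬c) = ⊥-elim (Sat∼⇒¬Sat {M = M} {⊕ c} ¬c sc)

  -- A link of `b` touching the atom of `m` meets the link (m, a) of `b`, hence equals it up to
  -- order and touches `a`. So avoiding `a` suffices to avoid all three fixed atoms.
  avoiding-Edges : ∀ {a b m U′ S} → C (⊕ a) (⊕ b) m →
    (∀ {v} → v ∈ U → v ≢ a → v ≢ b → v ≢ var m → v ∈ U′) →
    (∀ {M} → S M → K M × Sat M (⊖ b)) → All (Edge U′ S) (avoiding a b)
  avoiding-Edges {a} {b} {m} d free S⊆ = All.tabulate λ i →
    let l , ¬t = avoiding-sound i in
    link-Edge S⊆ (λ v∈ t → free v∈ (λ { refl → ¬t t }) (Link-¬Touches l t)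
      (λ { refl → ¬t (touches-a l t) })) l
    where
    touches-a : ∀ {q} → Link (⊕ b) q → Touches (var m) q → Touches a q
    touches-a l (inj₁ e) = inj₂ (cong var (proj₂ (links-disjoint l (C-rotate d) e)))
    touches-a l (inj₂ e) = inj₁ (cong var (proj₂ (links-disjoint (C-swap₂₃ l) (C-rotate d) e)))

  4≤links : ∀ {a} → a ∈ U → 4 ≤ length (links (⊕ a))
  4≤links {a} a∈ with 4 ≤? length (links (⊕ a))
  ... | yes 4≤ = 4≤
  -- 505482 and 296104 are `g 2` times z and z², for the two literals of a falsified link.
  ... | no  4≰ = ⊥-elim (unbounded (split {x = 3 * 296104} {g 3} (⊕ a) a∈ chk
    (Bd-≤ (*-monoˡ-≤ 296104 (≤-pred (≰⇒> 4≰))) (satisfy {x = g 2} {505482} a∈ chk chk after-link))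
    (falsify (⊕ a) 3 (≤ᵇ⇒≤ 3 5 tt) (3≤links a∈) a∈)))
    where
    -- Some literal of the link is positive. That atom is now false, and of its at least three links
    -- at most one touches `a`.
    after-link : ∀ {l m} → C (⊕ a) l m →
      Bd (U - a - var l - var m) (λ M → (K M × Sat M (⊕ a)) × Falsified (l , m) M) (g 2)
    after-link {b , true} {m} d =
      at-least 2 (avoiding a b) (≤ᵇ⇒≤ 2 5 tt) (avoiding-length a b (3≤links (C-free₂ d)))
        (avoiding-Edges d
          (λ v∈ ≢a ≢b ≢m → x∈p∧x≢y⇒x∈p-y (x∈p∧x≢y⇒x∈p-y (x∈p∧x≢y⇒x∈p-y v∈ ≢a) ≢b) ≢m)
          (λ ((k , _) , ¬b , _) → k , ¬b)) avoiding-differ (small₃ d)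
    after-link {l@(_ , false)} {b , true} d =
      at-least 2 (avoiding a b) (≤ᵇ⇒≤ 2 5 tt) (avoiding-length a b (3≤links (C-free₃ d)))
        (avoiding-Edges (C-swap₂₃ d)
          (λ v∈ ≢a ≢b ≢l → x∈p∧x≢y⇒x∈p-y (x∈p∧x≢y⇒x∈p-y (x∈p∧x≢y⇒x∈p-y v∈ ≢a) ≢l) ≢b)
          (λ ((k , _) , _ , ¬b) → k , ¬b)) avoiding-differ (small₃ d)
    after-link {_ , false} {_ , false} d = ⊥-elim (no-two-negatives d)

  no-free-atom : ∀ {a} → a ∈ U → ⊥
  -- 405188 and 237354 are `g 5` times z and z².
  no-free-atom {a} a∈ = unbounded (split {x = 4 * 237354} {g 4} (⊕ a) a∈ chk
    (Bd-≤ (*-monoˡ-≤ 237354 (links≤4 a∈)) (satisfy {x = g 5} {405188} a∈ chk chk after-link))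
    (falsify (⊕ a) 4 (≤ᵇ⇒≤ 4 5 tt) (4≤links a∈) a∈))
    where
    positive : ∀ {c y z} → ¬ C (⊖ c) y z
    positive d = 4≤links⇒positive (4≤links (C-free d)) d

    -- Since `y` is positive, its links (z, b) and (z, c) would meet in `z` and force `b` and `c` to
    -- coincide.
    no-twin-links : ∀ {b c y z} → b ≢ c → C (⊕ b) y z → ¬ C (⊕ c) y z
    no-twin-links {y = _ , false} b≢c d _ = positive (C-rotate d)
    no-twin-links {y = _ , true}  b≢c d d′ =
      b≢c (cong var (proj₂ (links-disjoint (C-rotate d) (C-rotate d′) refl)))

    after-link : ∀ {l m} → C (⊕ a) l m →
      Bd (U - a - var l - var m) (λ M → (K M × Sat M (⊕ a)) × Falsified (l , m) M) (g 5)
    after-link {_ , false} d = ⊥-elim (positive (C-rotate d))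
    after-link {_} {_ , false} d = ⊥-elim (positive (C-rotate (C-rotate d)))
    after-link {b , true} {c , true} d =
      -- Three links of `b` and three of `c` give six different clauses, of which five are used.
      at-least 5 (avoiding a b ++ avoiding a c) ≤-refl
        (≤-trans (≤ᵇ⇒≤ 5 6 tt) (≤-trans
          (+-mono-≤ {3} (avoiding-length a b (4≤links (C-free₂ d))) (avoiding-length a c (4≤links (C-free₃ d))))
          (≤-reflexive (sym (length-++ (avoiding a b))))))
        (All.++⁺
          (avoiding-Edges d
            (λ v∈ ≢a ≢b ≢c → x∈p∧x≢y⇒x∈p-y (x∈p∧x≢y⇒x∈p-y (x∈p∧x≢y⇒x∈p-y v∈ ≢a) ≢b) ≢c)
            (λ ((k , _) , ¬b , _) → k , ¬b))
          (avoiding-Edges (C-swap₂₃ d)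
            (λ v∈ ≢a ≢c ≢b → x∈p∧x≢y⇒x∈p-y (x∈p∧x≢y⇒x∈p-y (x∈p∧x≢y⇒x∈p-y v∈ ≢a) ≢b) ≢c)
            (λ ((k , _) , _ , ¬c) → k , ¬c)))
        (AllPairs.++⁺ avoiding-differ avoiding-differ
          (All.tabulate λ i → All.tabulate λ j →
            let d₁ , _ = avoiding-sound i
                d₂ , _ = avoiding-sound j
            in (λ { (refl , refl) → no-twin-links b≢c d₁ d₂ }) ,
               (λ { (refl , refl) → no-twin-links b≢c d₁ (C-swap₂₃ d₂) })))
        (small₃ d)
      where
      b≢c = C-apart₂₃ d

-- The formula left after fixing atoms.

-- The simplified formula is described by the set U of unfixed atoms and an
-- assignment M₀ giving the values of the fixed ones.
module Formula {n : ℕ} (F : List (List (Lit n))) (width : All (λ c → length c ≤ 3) F) where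

  -- `var l ≢ a` excludes tautologies such as the clause of a ← a, which give `a` no support;
  -- repetitions of `⊕ a` are allowed.
  Critical : Subset n → Fin n → List (Lit n) → Set
  Critical M a c = (⊕ a) ∈ˡ c × All (λ l → l ≡ ⊕ a ⊎ ¬ Sat M l × var l ≢ a) c

  Adm : Subset n → Set
  Adm M = All (Any (Sat M)) F × (∀ a → Sat M (⊕ a) → Any (Critical M a) F)

  open Counting Adm

  module Residual (U M₀ : Subset n) where

    K : Pred (Subset n) 0ℓ
    K M = Adm M × (∀ v → v ∉ U → lookup M v ≡ lookup M₀ v)

    FixedFalse : Lit n → Set
    FixedFalse l = var l ∉ U × ¬ Sat M₀ l

    -- After removal of the literals fixed to false, such a clause is a part of `R`, and therefore
    -- implies `R`.
    Within : List (Lit n) → List (Lit n) → Set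
    Within R = All (λ l → l ∈ˡ R ⊎ FixedFalse l)

    Within? : ∀ R → Decidable (Within R)
    Within? R = All.all? λ l → any? (l ≟ˡ_) R ⊎-dec (¬? (var l ∈? U) ×-dec ¬? (Sat? M₀ l))

    Within-⊆ : ∀ {R R′} → (∀ {l} → l ∈ˡ R → l ∈ˡ R′) → Any (Within R) F → Any (Within R′) F
    Within-⊆ R⊆ = Any.map (All.map [ inj₁ ∘ R⊆ , inj₂ ]′)

    Within-holds : ∀ {R M} → Any (Within R) F → K M → Any (Sat M) R
    Within-holds {R} {M} w ((sat , _) , agree) =
      let holds , within = All.lookupAny sat w
          l , l∈ , sl = find holds
      in [ (λ l∈R → lose l∈R sl) , (λ (l∉U , ¬sl) → ⊥-elim (¬sl (trans (sym (agree _ l∉U)) sl))) ]′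
           (All.lookup within l∈)

    C : Lit n → Lit n → Lit n → Set
    C x y z = (var x ≢ var y × var y ≢ var z × var x ≢ var z) ×
      (var x ∈ U × var y ∈ U × var z ∈ U) × Any (Within (x ∷ y ∷ z ∷ [])) F

    C? : ∀ x y z → Dec (C x y z)
    C? x y z =
      (¬? (var x Fin.≟ var y) ×-dec ¬? (var y Fin.≟ var z) ×-dec ¬? (var x Fin.≟ var z)) ×-dec
      (var x ∈? U ×-dec var y ∈? U ×-dec var z ∈? U) ×-dec any? (Within? (x ∷ y ∷ z ∷ [])) F

    C-swap₁₂ : ∀ {x y z} → C x y z → C y x z
    C-swap₁₂ ((xy , yz , xz) , (x∈ , y∈ , z∈) , w) =
      (≢-sym xy , xz , yz) , (y∈ , x∈ , z∈) , Within-⊆ exchange w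
      where
      exchange : ∀ {x y l : Lit n} {R} → l ∈ˡ x ∷ y ∷ R → l ∈ˡ y ∷ x ∷ R
      exchange (here e)          = there (here e)
      exchange (there (here e))  = here e
      exchange (there (there i)) = there (there i)

    C-swap₂₃ : ∀ {x y z} → C x y z → C x z y
    C-swap₂₃ ((xy , yz , xz) , (x∈ , y∈ , z∈) , w) =
      (xz , ≢-sym yz , xy) , (x∈ , z∈ , y∈) , Within-⊆ exchange w
      where
      exchange : ∀ {x y z l : Lit n} → l ∈ˡ x ∷ y ∷ z ∷ [] → l ∈ˡ x ∷ z ∷ y ∷ []
      exchange (here e)                  = here e
      exchange (there (here e))          = there (there (here e))
      exchange (there (there (here e)))  = there (here e)

    C-holds : ∀ {x y z M} → C x y z → K M → Sat M x ⊎ Sat M y ⊎ Sat M z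
    C-holds {M = M} (_ , _ , w) k with Within-holds {M = M} w k
    ... | here s                 = inj₁ s
    ... | there (here s)         = inj₂ (inj₁ s)
    ... | there (there (here s)) = inj₂ (inj₂ s)

    module _ (ih : ∀ {U′ S} → ∣ U′ ∣ < ∣ U ∣ → Bd U′ S one) (unbounded : ¬ Bd U K one) where

      open TwoClauses Adm ∣ U ∣ ih

      no-unit : ∀ {a} → a ∈ U → ¬ Any (Within (⊕ a ∷ [])) F
      no-unit {a} a∈ w = unbounded (force {x = one} (⊕ a) a∈ (λ {M} → holds {M}) chk (ih (x∈p⇒∣p-x∣<∣p∣ a∈)))
        where
        holds : ∀ {M} → K M → Sat M (⊕ a)
        holds {M} k with Within-holds {M = M} w k
        ... | here s = s

      -- If `a` is false then `l` is forced, and z (1 + z) ≤ 1.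
      no-binary : ∀ {a l} → a ∈ U → var l ∈ U → var l ≢ a → ¬ Any (Within (⊕ a ∷ l ∷ [])) F
      no-binary {a} {l} a∈ l∈ l≢a w = unbounded (split {x = one} {Z 1} (⊕ a) a∈ chk
        (ih (x∈p⇒∣p-x∣<∣p∣ a∈))
        (force-other {S = K} {l = ⊕ a} {l} {one} (edge (≢-sym l≢a) a∈ l∈ (λ {M} → holds {M})) (Z-step 0)
          (ih (Small-minus (x∈p∧x≢y⇒x∈p-y l∈ l≢a) (x∈p⇒∣p-x∣<∣p∣ a∈)))))
        where
        holds : ∀ {M} → K M → Sat M (⊕ a) ⊎ Sat M l
        holds {M} k with Within-holds {M = M} w k
        ... | here s         = inj₁ s
        ... | there (here s) = inj₂ s

      -- Besides `⊕ a`, at most two literals on free atoms remain in the critical clause. Unless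
      -- they form a link, a clause excluded by `no-unit` or `no-binary` arises; complementary
      -- literals cannot both be false.
      critical : ∀ {a M} → a ∈ U → K M → Sat M (⊕ a) →
        ∃₂ λ l m → C (⊕ a) l m × Sat M (∼ l) × Sat M (∼ m)
      critical {a} {M} a∈ ((_ , crit) , agree) sa = find-link R refl
        where
        c∈     = proj₁ (proj₂ (find (crit a sa)))
        c      = proj₁ (find (crit a sa))
        crit-c = proj₂ (proj₂ (find (crit a sa)))

        P? : Decidable (λ l → l ≢ ⊕ a × var l ∈ U)
        P? l = ¬? (l ≟ˡ ⊕ a) ×-dec (var l ∈? U)

        R = filter P? c

        R≤2 : length R ≤ 2
        R≤2 = ≤-pred (≤-trans (filter-notAll P? c (Any.map (λ e p → proj₁ p (sym e)) (proj₁ crit-c)))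
                              (All.lookup width c∈))

        R-false : All (λ l → ¬ Sat M l × var l ≢ a × var l ∈ U) R
        R-false = All.tabulate λ i → let j , l≢ , l∈ = ∈-filter⁻ P? {xs = c} i in
          [ (λ e → contradiction e l≢) , (λ (¬s , l≢a) → ¬s , l≢a , l∈) ]′ (All.lookup (proj₂ crit-c) j)

        within : Any (Within (⊕ a ∷ R)) F
        within = lose c∈ (All.tabulate place)
          where
          place : ∀ {l} → l ∈ˡ c → l ∈ˡ ⊕ a ∷ R ⊎ FixedFalse l
          place {l} i with All.lookup (proj₂ crit-c) i | var l ∈? U
          ... | inj₁ refl       | _      = inj₁ (here refl)
          ... | inj₂ (¬s , l≢a) | yes l∈ = inj₁ (there (∈-filter⁺ P? i ((λ { refl → l≢a refl }) , l∈)))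
          ... | inj₂ (¬s , l≢a) | no  l∉ = inj₂ (l∉ , λ s → ¬s (trans (agree _ l∉) s))

        find-link : ∀ R′ → R ≡ R′ → ∃₂ λ l m → C (⊕ a) l m × Sat M (∼ l) × Sat M (∼ m)
        find-link R′ eq with R′ | subst (λ R → length R ≤ 2) eq R≤2
                            | subst (All _) eq R-false | subst (λ R → Any (Within (⊕ a ∷ R)) F) eq within
        ... | []    | _ | _ | w = ⊥-elim (no-unit a∈ w)
        ... | l ∷ [] | _ | (_ , l≢a , l∈) ∷ [] | w = ⊥-elim (no-binary a∈ l∈ l≢a w)
        ... | l ∷ m ∷ [] | _ | (¬l , l≢a , l∈) ∷ (¬m , m≢a , m∈) ∷ [] | w with var l Fin.≟ var m
        ...   | no l≢m = l , m , ((≢-sym l≢a , l≢m , ≢-sym m≢a) , (a∈ , l∈ , m∈) , w) ,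
                         ¬Sat⇒Sat∼ {M = M} ¬l , ¬Sat⇒Sat∼ {M = M} ¬m
        ...   | yes e with same-var {x = l} {m} e
        ...     | inj₂ refl = ⊥-elim (¬l (¬Sat⇒Sat∼ {M = M} ¬m))
        ...     | inj₁ refl = ⊥-elim (no-binary a∈ l∈ l≢a (Within-⊆ merge w))
          where
          merge : ∀ {l k} → k ∈ˡ ⊕ a ∷ l ∷ l ∷ [] → k ∈ˡ ⊕ a ∷ l ∷ []
          merge (here e)                 = here e
          merge (there (here e))         = there (here e)
          merge (there (there (here e))) = there (here e)
        find-link R′ eq | _ ∷ _ ∷ _ ∷ _ | s≤s (s≤s ()) | _ | _

      no-free : ∀ {a} → a ∈ U → ⊥
      no-free = Branching.no-free-atom Adm U K ih C C? C-swap₁₂ C-swap₂₃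
        (proj₁ ∘ proj₁) (proj₁ ∘ proj₁ ∘ proj₂)
        (λ {_} {_} {_} {M} → C-holds {M = M}) (λ {_} {M} → critical {M = M}) unbounded

  -- The first listed assignment supplies the values of the fixed atoms. The double negation
  -- disappears because the inequality is decidable. With no free atom left the list has at most one
  -- member, and `D ≤ x` covers it.
  Bd-residual : ∀ {U S x} → D ≤ x →
    (∀ M₀ {a} → a ∈ U → ¬ ¬ Bd U (Residual.K U M₀) x) → Bd U S x
  Bd-residual D≤x ¬¬bd .bound [] _ _ _ _ = z≤n
  Bd-residual {U} {S} {x} D≤x ¬¬bd .bound Ms@(M₀ ∷ _) u ad ag _ with nonempty? U
  ... | yes (a , a∈) = decidable-stable (_ ≤? _) λ ≰ →
    ¬¬bd M₀ a∈ λ bd → ≰ (bd .bound Ms u ad ag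
      (All.tabulate λ i → All.lookup ad i , ag i (here refl)))
  ... | no ¬ne = ≤-trans
      (*-mono-≤ (at-most-one u ag) (*-mono-≤ D≤x (^-monoˡ-≤ ∣ U ∣ A≤B)))
      (≤-reflexive (*-identityˡ _))
    where
    at-most-one : ∀ {Ms} → Unique Ms → Agree U Ms → length Ms ≤ 1
    at-most-one [] _ = z≤n
    at-most-one (_ ∷ []) _ = s≤s z≤n
    at-most-one ((M≢ ∷ _) ∷ _ ∷ _) ag = contradiction
      (trans (sym (tabulate∘lookup _)) (trans
        (tabulate-cong (λ v → ag (here refl) (there (here refl)) v (λ v∈ → ¬ne (v , v∈))))
        (tabulate∘lookup _))) M≢

  count : ∀ r {U S} → ∣ U ∣ < r → Bd U S one
  count (suc r) {U} (s≤s U≤r) = Bd-residual (≤-reflexive D≡one) λ M₀ a∈ unbounded →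
    Residual.no-free U M₀ (λ U′< → count r (≤-trans U′< U≤r)) unbounded a∈

-- From programs to clauses.

bodyLit : ∀ {n} → Literal n → Lit n
bodyLit (pos a) = ⊖ a
bodyLit (neg a) = ⊕ a

ruleClauses : ∀ {n} → Program n → List (List (Lit n))
ruleClauses []                  = []
ruleClauses ((nothing ⇐ _) ∷ P) = ruleClauses P
ruleClauses ((just p ⇐ b) ∷ P)  = (⊕ p ∷ map bodyLit b) ∷ ruleClauses P

ruleClauses-width : ∀ {n} {P : Program n} → Is3Program P → All (λ c → length c ≤ 3) (ruleClauses P)
ruleClauses-width [] = []
ruleClauses-width {P = (nothing ⇐ _) ∷ P} (_ ∷ ws) = ruleClauses-width ws
ruleClauses-width {P = (just p ⇐ b) ∷ P} (w ∷ ws) =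
  ≤-trans (≤-reflexive (cong suc (length-map bodyLit b))) w ∷ ruleClauses-width ws

blocked⇒Sat : ∀ {n} {M : Subset n} b → blocked M b ≡ true → Any (Sat M) (map bodyLit b)
blocked⇒Sat (pos a ∷ b) e = there (blocked⇒Sat b e)
blocked⇒Sat {M = M} (neg a ∷ b) e with a ∈? M
... | yes a∈ = here ([]=⇒lookup a∈)
... | no  _  = there (blocked⇒Sat b e)

posAtom-false⇒Sat : ∀ {n} {M : Subset n} b → ¬ All (_∈ M) (posAtoms b) → Any (Sat M) (map bodyLit b)
posAtom-false⇒Sat [] ¬all = contradiction [] ¬all
posAtom-false⇒Sat {M = M} (pos a ∷ b) ¬all with Sat? M (⊖ a)
... | yes s = here s
... | no ¬s = there (posAtom-false⇒Sat b λ all → ¬all (lookup⇒[]= a M (¬Sat⇒Sat∼ {M = M} {⊖ a} ¬s) ∷ all))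
posAtom-false⇒Sat (neg a ∷ b) ¬all = there (posAtom-false⇒Sat b ¬all)

reduct-model⇒Sat : ∀ {n} {M : Subset n} P → ModelOf M (reduct M P) → All (Any (Sat M)) (ruleClauses P)
reduct-model⇒Sat [] _ = []
reduct-model⇒Sat ((nothing ⇐ _) ∷ P) model = reduct-model⇒Sat P model
reduct-model⇒Sat {M = M} ((just p ⇐ b) ∷ P) model with blocked M b in eq
... | true = there (blocked⇒Sat b eq) ∷ reduct-model⇒Sat P model
... | false with model
...   | m ∷ ms with All.all? (_∈? M) (posAtoms b)
...     | yes all = here ([]=⇒lookup (m all)) ∷ reduct-model⇒Sat P ms
...     | no ¬all = there (posAtom-false⇒Sat b ¬all) ∷ reduct-model⇒Sat P ms

module _ {n : ℕ} {M : Subset n} {a : Fin n} (a∈ : a ∈ M) where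

  private
    M∖a : Subset n
    M∖a = M [ a ]≔ false

    a∉M∖a : a ∉ M∖a
    a∉M∖a i with () ← trans (sym (lookup∘update a M false)) ([]=⇒lookup i)

    ∈M∖a⁻ : ∀ {x} → x ∈ M∖a → x ∈ M × x ≢ a
    ∈M∖a⁻ {x} i = lookup⇒[]= x M (trans (sym (lookup∘update′ x≢a M false)) ([]=⇒lookup i)) , x≢a
      where
      x≢a : x ≢ a
      x≢a refl = a∉M∖a i

    ∈M∖a⁺ : ∀ {x} → x ∈ M → x ≢ a → x ∈ M∖a
    ∈M∖a⁺ {x} i x≢a = lookup⇒[]= x M∖a (trans (lookup∘update′ x≢a M false) ([]=⇒lookup i))

    FalseApart : Lit n → Set
    FalseApart l = ¬ Sat M l × var l ≢ a

    -- Positive body atoms lie in `M` but differ from `a`; negated ones lie outside `M`, whereas `a`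
    -- is in `M`.
    body-false : ∀ b → blocked M b ≡ false → All (_∈ M∖a) (posAtoms b) → All FalseApart (map bodyLit b)
    body-false [] _ _ = []
    body-false (pos x ∷ b) e (x∈ ∷ xs∈) =
      ((λ s → true≢false (trans (sym ([]=⇒lookup (proj₁ (∈M∖a⁻ x∈)))) s)) , proj₂ (∈M∖a⁻ x∈))
        ∷ body-false b e xs∈
      where
      true≢false : true ≢ false
      true≢false ()
    body-false (neg x ∷ b) e xs∈ with x ∈? M
    ... | no x∉ = ((λ s → x∉ (lookup⇒[]= x M s)) , (λ { refl → x∉ a∈ })) ∷ body-false b e xs∈

  -- A rule of the reduct that fails once `a` is removed has its positive body in `M` without `a`.
  -- As `M` satisfies the rule, its head is in `M`, so it must be `a`.
  supported : ∀ P → ModelOf M (reduct M P) → ¬ ModelOf M∖a (reduct M P) →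
    Any (λ c → ⊕ a ∈ˡ c × All (λ l → l ≡ ⊕ a ⊎ FalseApart l) c) (ruleClauses P)
  supported [] _ ¬model = contradiction [] ¬model
  supported ((nothing ⇐ _) ∷ P) model ¬model = supported P model ¬model
  supported ((just p ⇐ b) ∷ P) model ¬model with blocked M b in eq
  ... | true = there (supported P model ¬model)
  ... | false with model
  ...   | m ∷ ms with All.all? (_∈? M∖a) (posAtoms b) | p Fin.≟ a
  ...     | no ¬all | _ = there (supported P ms λ ms′ → ¬model ((λ all → contradiction all ¬all) ∷ ms′))
  ...     | yes all | yes refl = here (here refl , inj₁ refl ∷ All.map inj₂ (body-false b eq all))
  ...     | yes all | no p≢a = there (supported P ms λ ms′ →
              ¬model ((λ _ → ∈M∖a⁺ (m (All.map (proj₁ ∘ ∈M∖a⁻) all)) p≢a) ∷ ms′))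

  least⇒supported : ∀ P → LeastModel M (reduct M P) →
    Any (λ c → ⊕ a ∈ˡ c × All (λ l → l ≡ ⊕ a ⊎ FalseApart l) c) (ruleClauses P)
  least⇒supported P (model , least) = supported P model λ model′ → a∉M∖a (least M∖a model′ a∈)

-- The bound for programs.

unscale : ∀ {A′ B′ D′ a b d} k m .{{_ : NonZero d}} → A′ ≡ a → B′ ≡ b → D′ ≡ d →
  k * (D′ * A′ ^ m) ≤ d * B′ ^ m → k * a ^ m ≤ 1 * b ^ m
unscale {a = a} {b} {d} k m refl refl refl h = ≤-trans
  (*-cancelˡ-≤ d (≤-trans (≤-reflexive (exchange d k (a ^ m))) h))
  (≤-reflexive (sym (*-identityˡ (b ^ m))))
  where
  exchange : ∀ d k p → d * (k * p) ≡ k * (d * p)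
  exchange = solve-∀

theorem10 : ∃ λ (C : ℕ) →
    (n : ℕ) (P : Program n) → Is3Program P → AtomsAre P →
    (Ms : List (Subset n)) → Unique Ms → All (StableModel P) Ms →
    length Ms * 100000 ^ n ≤ C * 170711 ^ n
theorem10 = 1 , λ n P 3P _ Ms unique stable →
  let open Formula (ruleClauses P) (ruleClauses-width 3P)
      open Counting Adm using (bound)
      admissible = All.map (λ { {M} (_ , lm) → reduct-model⇒Sat P (proj₁ lm) ,
                     λ a sa → least⇒supported (lookup⇒[]= a M sa) P lm }) stable
  in subst (λ m → length Ms * 100000 ^ m ≤ 1 * 170711 ^ m) (∣⊤∣≡n n)
       (unscale {d = one} (length Ms) ∣ ⊤ {n} ∣ A≡ B≡ D≡one
         -- Initially every atom is free, so agreement outside `⊤` is vacuous; the weight `one`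
         -- yields the constant 1.
         (count (suc ∣ ⊤ {n} ∣) {⊤} {λ _ → Unit.⊤} ≤-refl .bound
           Ms unique admissible (λ _ _ _ v∉ → contradiction ∈⊤ v∉) (All.map (λ _ → tt) stable)))
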